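{- A simple proposition $\varphi$ is valid if and only if there exist a dualizing net $N$ and a skew fibration of dualizing graphs $f:N\to\mathcal D(\varphi)$.
   Context: Propositions are formulas built from nullary predicate symbols and the constants $1,0$ by $\wedge,\vee$ (no quantifiers, no terms); each predicate symbol $p$ has a dual $\bar p\neq p$ with $\bar{\bar p}=p$, and validity is classical. A proposition is simple if it contains no $1$ or $0$. A cograph is a graph with no induced four-vertex path; a graph is triangle-free if it has no induced triangle. A dualizing graph $D$ is a nonempty cograph $(V(D),E(D))$ together with a second set $\Delta(D)$ of undirected edges on $V(D)$ (dualities) such that $(V(D),\Delta(D))$ is a triangle-free cograph. The dualizing graph $\mathcal D(\varphi)$ of a simple proposition has as vertices the occurrences of predicate symbols in $\varphi$, an edge $vw$ iff the smallest subformula containing both $v$ and $w$ is a conjunction, and a duality $vw$ iff $v,w$ have dual predicate symbols. A graph is a matching if it is nonempty and every vertex has exactly one neighbour. A set $W$ induces a bimatching in $D$ if it induces a matching in $(V(D),E(D))$ and in $(V(D),\Delta(D))$. A dualizing net is a dualizing graph $N$ with no induced bimatching such that $(V(N),\Delta(N))$ is a matching. An undirected graph homomorphism $f:G\to H$ is a skew fibration if for every $v\in V(G)$ and edge $w f(v)\in E(H)$ there exists $\hat w$ with $\hat w v\in E(G)$ and $f(\hat w)w\notin E(H)$. A skew fibration of dualizing graphs $f:N\to D$ is a skew fibration $(V(N),E(N))\to(V(D),E(D))$ that is also a graph homomorphism $(V(N),\Delta(N))\to(V(D),\Delta(D))$. -}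

module Defs where

open import Data.Nat using (ℕ)
open import Data.Bool using (Bool; true; false; not)
open import Data.Product using (Σ; _×_; _,_; ∃)
open import Data.Empty using (⊥)
open import Data.Unit using (⊤)
open import Relation.Nullary using (¬_)
open import Relation.Binary.PropositionalEquality using (_≡_)

-- Predicate symbols: every symbol comes with a dual, the duality being a
-- fixed-point-free involution.  We present the symbols as pos n / neg n,
-- with dual (pos n) = neg n and dual (neg n) = pos n.
data Atom : Set where
  pos : ℕ → Atom
  neg : ℕ → Atom

dual : Atom → Atom
dual (pos n) = neg n
dual (neg n) = pos n

infixr 6 _∧_
infixr 5 _∨_

data Form : Set where
  atom : Atom → Form
  𝟙    : Form
  𝟘    : Form
  _∧_  : Form → Form → Form
  _∨_  : Form → Form → Form

data Simple : Form → Set where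
  atom : (a : Atom) → Simple (atom a)
  _∧_  : {φ ψ : Form} → Simple φ → Simple ψ → Simple (φ ∧ ψ)
  _∨_  : {φ ψ : Form} → Simple φ → Simple ψ → Simple (φ ∨ ψ)

evalAtom : (ℕ → Bool) → Atom → Bool
evalAtom ρ (pos n) = ρ n
evalAtom ρ (neg n) = not (ρ n)

and : Bool → Bool → Bool
and true  b = b
and false _ = false

or : Bool → Bool → Bool
or true  _ = true
or false b = b

eval : (ℕ → Bool) → Form → Bool
eval ρ (atom a) = evalAtom ρ a
eval ρ 𝟙        = true
eval ρ 𝟘        = false
eval ρ (φ ∧ ψ)  = and (eval ρ φ) (eval ρ ψ)
eval ρ (φ ∨ ψ)  = or (eval ρ φ) (eval ρ ψ)

Valid : Form → Set
Valid φ = (ρ : ℕ → Bool) → eval ρ φ ≡ true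

record BiGraph (V : Set) : Set₁ where
  field
    E : V → V → Set
    Δ : V → V → Set
open BiGraph public

IsUndirected : {V : Set} → (V → V → Set) → Set
IsUndirected {V} R = ((v w : V) → R v w → R w v) × ((v : V) → ¬ R v v)

IsCograph : {V : Set} → (V → V → Set) → Set
IsCograph {V} R = IsUndirected R ×
  ((a b c d : V) → R a b → R b c → R c d → ¬ R a c → ¬ R b d → ¬ R a d → ⊥)

IsTriangleFree : {V : Set} → (V → V → Set) → Set
IsTriangleFree {V} R = (a b c : V) → R a b → R b c → R a c → ⊥

IsDualizingGraph : {V : Set} → BiGraph V → Set
IsDualizingGraph {V} D =
  V × IsCograph (E D) × IsCograph (Δ D) × IsTriangleFree (Δ D)

InducesMatching : {V : Set} → (V → V → Set) → (V → Bool) → Set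
InducesMatching {V} R W =
  (Σ V λ v → W v ≡ true) ×
  ((v : V) → W v ≡ true →
     Σ V λ w → W w ≡ true × R v w ×
       ((u : V) → W u ≡ true → R v u → u ≡ w))

IsMatching : {V : Set} → (V → V → Set) → Set
IsMatching R = InducesMatching R (λ _ → true)

InducesBimatching : {V : Set} → BiGraph V → (V → Bool) → Set
InducesBimatching D W = InducesMatching (E D) W × InducesMatching (Δ D) W

IsDualizingNet : {V : Set} → BiGraph V → Set
IsDualizingNet {V} N =
  IsDualizingGraph N ×
  ¬ (Σ (V → Bool) λ W → InducesBimatching N W) ×
  IsMatching (Δ N)

IsSkewFibration : {V W : Set} → BiGraph V → BiGraph W → (V → W) → Set
IsSkewFibration {V} {W} N D f =
  ((v w : V) → E N v w → E D (f v) (f w)) ×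
  ((v : V) (w : W) → E D w (f v) →
     Σ V λ ŵ → E N ŵ v × ¬ E D (f ŵ) w) ×
  ((v w : V) → Δ N v w → Δ D (f v) (f w))

data Occ : Form → Set where
  here : (a : Atom) → Occ (atom a)
  ∧l   : {φ ψ : Form} → Occ φ → Occ (φ ∧ ψ)
  ∧r   : {φ ψ : Form} → Occ ψ → Occ (φ ∧ ψ)
  ∨l   : {φ ψ : Form} → Occ φ → Occ (φ ∨ ψ)
  ∨r   : {φ ψ : Form} → Occ ψ → Occ (φ ∨ ψ)

label : {φ : Form} → Occ φ → Atom
label (here a) = a
label (∧l v) = label v
label (∧r v) = label v
label (∨l v) = label v
label (∨r v) = label v

-- Conj v w : the smallest subformula containing both v and w is a
-- conjunction.
data Conj : {φ : Form} → Occ φ → Occ φ → Set where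
  lr  : {φ ψ : Form} {v : Occ φ} {w : Occ ψ} → Conj (∧l {φ} {ψ} v) (∧r w)
  rl  : {φ ψ : Form} {v : Occ φ} {w : Occ ψ} → Conj (∧r {φ} {ψ} w) (∧l v)
  ∧ll : {φ ψ : Form} {v w : Occ φ} → Conj v w → Conj (∧l {φ} {ψ} v) (∧l w)
  ∧rr : {φ ψ : Form} {v w : Occ ψ} → Conj v w → Conj (∧r {φ} {ψ} v) (∧r w)
  ∨ll : {φ ψ : Form} {v w : Occ φ} → Conj v w → Conj (∨l {φ} {ψ} v) (∨l w)
  ∨rr : {φ ψ : Form} {v w : Occ ψ} → Conj v w → Conj (∨r {φ} {ψ} v) (∨r w)

DualOcc : {φ : Form} → Occ φ → Occ φ → Set
DualOcc v w = dual (label v) ≡ label w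

𝒟 : (φ : Form) → BiGraph (Occ φ)
𝒟 φ = record { E = Conj ; Δ = DualOcc }

{-# OPTIONS --safe #-}
-- Soundness.  A valuation falsifying φ selects a maximal stable set (a clause) of false
-- literals in 𝒟 φ.  Its preimage under a skew fibration is again a maximal stable set,
-- and it contains no duality because dual literals are not both false.  From a vertex of
-- this set pass to its mate and then, by maximality, to a neighbour in the set; a
-- shortest cycle of such steps induces a bimatching.
--
-- Completeness.  A clause of a valid proposition contains a dual pair, which alone is a
-- net over the clause.  Nets over φ ∨ χ and ψ ∨ χ combine to one over (φ ∧ ψ) ∨ χ by
-- joining the vertices over φ to those over ψ; if there are none on one side, that net
-- already serves.  No bimatching arises because every nonempty set closed under duality
-- in which all E-degrees are at most one has at least two isolated vertices.
module Submission where

open import Defs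
open import Data.Nat using (ℕ)
open import Data.Nat.Properties using (1+n≰n) renaming (_≟_ to _≟ⁿ_)
open import Data.Bool using (Bool; true; false; not)
open import Data.Bool.Properties using (¬-not; not-involutive; not-¬) renaming (_≟_ to _≟ᵇ_)
open import Data.Empty using (⊥; ⊥-elim)
open import Data.Fin using (Fin)
open import Data.Fin.Properties
  using (any?; all?; sequence; injective⇒≤; punchOut-injective; 2↔Bool; +↔⊎)
  renaming (_≟_ to _≟ᶠ_)
open import Data.Fin.Subset using (Subset; Nonempty; _∈_; _∉_; _⊆_; _⊂_; _-_)
open import Data.Fin.Subset.Induction using (⊂-wellFounded)
open import Data.Fin.Subset.Properties
  using (_∈?_; ⊆-refl; ⊆-trans; p─q⊆p; x∈p⇒p-x⊂p; x∈p∧x≢y⇒x∈p-y)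
open import Data.Product using (Σ; ∃; ∃₂; _×_; _,_; proj₁; proj₂)
open import Data.Sum using (_⊎_; inj₁; inj₂; [_,_]; map)
open import Data.Sum.Function.Propositional using (_⊎-↔_)
open import Data.Sum.Properties using (inj₁-injective; inj₂-injective)
open import Data.Unit using (⊤; tt)
open import Data.Vec using (tabulate)
open import Data.Vec.Properties using (lookup∘tabulate; []=⇒lookup; lookup⇒[]=)
open import Effect.Monad using (RawMonad)
open import Function using (_∘_; case_of_)
open import Function.Bundles using (_⇔_; mk⇔; _↔_; Inverse)
open import Function.Definitions using (Injective)
open import Function.Properties.Inverse using (↔-trans)
open import Induction.WellFounded using (Acc; acc)
open import Level using (0ℓ)
open import Relation.Binary.PropositionalEquality
  using (_≡_; _≢_; refl; sym; trans; cong; subst; subst₂)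
open import Relation.Nullary using (¬_; Dec; does; yes; no; contradiction)
open import Relation.Nullary.Decidable
  using (_×-dec_; _⊎-dec_; _→-dec_; ¬?; map′; dec-true; decidable-stable; ¬¬-excluded-middle)
open import Relation.Nullary.Negation using (¬¬-Monad)

-- Chordless cycles

-- Pigeonhole: a missed value `y` could be punched out of the codomain, leaving an injection into a
-- smaller finite set.
injective⇒surjective : ∀ {n} {f : Fin n → Fin n} → Injective _≡_ _≡_ f → ∀ y → ∃ λ x → f x ≡ y
injective⇒surjective {ℕ.suc n} {f} inj y with any? (λ x → f x ≟ᶠ y)
... | yes hit  = hit
... | no  miss = contradiction
  (injective⇒≤ (λ eq → inj (punchOut-injective (avoid _) (avoid _) eq))) 1+n≰n
  where
  avoid : ∀ x → y ≢ f x
  avoid x eq = miss (x , sym eq)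

Uniquely : ∀ {n} → Subset n → (Fin n → Set) → Set
Uniquely X P = ∃ λ x → x ∈ X × P x × (∀ y → y ∈ X → P y → y ≡ x)

module _ {n} {R : Fin n → Fin n → Set} (R? : ∀ v w → Dec (R v w)) where

  Serial : Subset n → Set
  Serial X = ∀ v → v ∈ X → ∃ λ w → w ∈ X × R v w

  -- Such a `u` is the obstruction to deleting `v` from a serial set: it would be left without a
  -- successor.
  UniquelySucceededBy : Subset n → Fin n → Fin n → Set
  UniquelySucceededBy X v u = u ∈ X × R u v × (∀ w → w ∈ X → R u w → w ≡ v)

  uniquelySucceededBy? : ∀ X v u → Dec (UniquelySucceededBy X v u)
  uniquelySucceededBy? X v u = (u ∈? X) ×-dec R? u v ×-dec
    all? (λ w → (w ∈? X) →-dec (R? u w →-dec (w ≟ᶠ v)))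

  -- A vertex all of whose successors in `X` equal `v` has at least one by seriality, hence is
  -- uniquely succeeded by `v`. The case `u = v` is included because the successor of `v` shows that
  -- `X - v` is nonempty.
  serial-remove : ∀ {X} v → Serial X → ¬ ∃ (UniquelySucceededBy X v) →
                  ∀ u → u ∈ X → ∃ λ w → w ∈ X - v × R u w
  serial-remove {X} v serial none u u∈X
    with any? (λ w → (w ∈? X) ×-dec R? u w ×-dec ¬? (w ≟ᶠ v))
  ... | yes (w , w∈X , Ruw , w≢v) = w , x∈p∧x≢y⇒x∈p-y w∈X w≢v , Ruw
  ... | no only =
    let only-v w w∈X Ruw = decidable-stable (w ≟ᶠ v) (λ w≢v → only (w , w∈X , Ruw , w≢v))
        w , w∈X , Ruw    = serial u u∈X
    in contradiction (u , u∈X , subst (R u) (only-v w w∈X Ruw) Ruw , only-v) none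

  -- In a minimal serial set no vertex can be removed, hence each is the only
  -- successor of some vertex.
  minimal-serial : ∀ {T} → Acc _⊂_ T → Nonempty T → Serial T →
    ∃ λ X → X ⊆ T × Nonempty X × (∀ v → v ∈ X → ∃ (UniquelySucceededBy X v))
  minimal-serial {T} (acc smaller) nonempty serial
    with any? (λ v → (v ∈? T) ×-dec ¬? (any? (uniquelySucceededBy? T v)))
  ... | no all = T , ⊆-refl , nonempty , λ v v∈T →
    decidable-stable (any? (uniquelySucceededBy? T v)) (λ none → all (v , v∈T , none))
  ... | yes (v , v∈T , none) =
    let step               = serial-remove v serial none
        w , w∈T-v , _      = step v v∈T
        X , X⊆ , ne , sole = minimal-serial (smaller (x∈p⇒p-x⊂p v∈T)) (w , w∈T-v)
                               (λ u u∈ → step u (p─q⊆p T _ u∈))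
    in X , ⊆-trans X⊆ (p─q⊆p T _) , ne , sole

  -- Choosing for each `v` a vertex whose only successor is `v` gives an injective map, as the
  -- chosen vertex determines `v`. On a finite set it is also surjective, so every vertex of `X` is
  -- a chosen one, and `R` restricted to `X` is a permutation.
  sole-predecessors⇒cyclic : ∀ {X} → (∀ v → v ∈ X → ∃ (UniquelySucceededBy X v)) →
    ∀ v → v ∈ X → Uniquely X (R v) × Uniquely X (λ u → R u v)
  sole-predecessors⇒cyclic {X} sole v v∈X = successor v v∈X , predecessor
    where
    -- Outside `X` the choice is the identity, so that `pred` is a total self-map of `Fin n` to
    -- which the pigeonhole principle applies.
    choose : ∀ v → ∃ λ u → (v ∈ X → UniquelySucceededBy X v u) × (v ∉ X → u ≡ v)
    choose v with v ∈? X
    ... | yes v∈X = let u , s = sole v v∈X in u , (λ _ → s) , contradiction v∈X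
    ... | no  v∉X = v , (λ v∈X → contradiction v∈X v∉X) , λ _ → refl

    pred : Fin n → Fin n
    pred v = proj₁ (choose v)

    inside : ∀ {v} → v ∈ X → UniquelySucceededBy X v (pred v)
    inside {v} = proj₁ (proj₂ (choose v))

    outside : ∀ {v} → v ∉ X → pred v ≡ v
    outside {v} = proj₂ (proj₂ (choose v))

    reflects-∈ : ∀ {v} → pred v ∈ X → v ∈ X
    reflects-∈ {v} pv∈X = decidable-stable (v ∈? X)
      (λ v∉X → v∉X (subst (_∈ X) (outside v∉X) pv∈X))

    pred-injective : Injective _≡_ _≡_ pred
    pred-injective {v} {w} eq = by-cases (v ∈? X)
      where
      by-cases : Dec (v ∈ X) → v ≡ w
      by-cases (yes v∈X) =
        let pv∈X , Rpv , _ = inside v∈X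
            _ , _ , only   = inside (reflects-∈ (subst (_∈ X) eq pv∈X))
        in only v v∈X (subst (λ u → R u v) eq Rpv)
      by-cases (no v∉X) = trans (sym (outside v∉X)) (trans eq (outside w∉X))
        where
        w∉X : w ∉ X
        w∉X w∈X = v∉X (reflects-∈ (subst (_∈ X) (sym eq) (proj₁ (inside w∈X))))

    successor : ∀ u → u ∈ X → Uniquely X (R u)
    successor u u∈X with injective⇒surjective pred-injective u
    ... | s , refl = let s∈X = reflects-∈ {s} u∈X
                         _ , Rus , only = inside s∈X
                     in s , s∈X , Rus , only

    predecessor : Uniquely X (λ u → R u v)
    predecessor = pred v , proj₁ (inside v∈X) , proj₁ (proj₂ (inside v∈X)) , only
      where
      only : ∀ u → u ∈ X → R u v → u ≡ pred v
      only u u∈X Ruv with injective⇒surjective pred-injective u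
      ... | s , refl = cong pred (sym (proj₂ (proj₂ (inside (reflects-∈ {s} u∈X))) v v∈X Ruv))

  -- The conclusion describes a disjoint union of directed cycles with no further `R`-steps between
  -- their vertices.
  chordless-cycle : ∀ {T} → Nonempty T → Serial T →
    ∃ λ X → X ⊆ T × Nonempty X ×
      (∀ v → v ∈ X → Uniquely X (R v) × Uniquely X (λ u → R u v))
  chordless-cycle nonempty serial =
    let X , X⊆T , ne , sole = minimal-serial (⊂-wellFounded _) nonempty serial
    in X , X⊆T , ne , sole-predecessors⇒cyclic sole

-- Dualizing nets

does-true⁻ : ∀ {A : Set} (A? : Dec A) → does A? ≡ true → A
does-true⁻ (yes a) _ = a

module _ {n} (N : BiGraph (Fin n)) (net : IsDualizingNet N) where

  private
    E-cograph = proj₁ (proj₂ (proj₁ net))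
    Δ-undirected = proj₁ (proj₁ (proj₂ (proj₂ (proj₁ net))))
    Δ-matching = proj₂ (proj₂ (proj₂ net))

    E-sym : ∀ {v w} → E N v w → E N w v
    E-sym = proj₁ (proj₁ E-cograph) _ _

    P4-free : ∀ {a b c d} → E N a b → E N b c → E N c d →
              ¬ E N a c → ¬ E N b d → ¬ E N a d → ⊥
    P4-free = proj₂ E-cograph _ _ _ _

  mate : Fin n → Fin n
  mate v = proj₁ (Δ-matching v refl)

  Δ-mate : ∀ v → Δ N v (mate v)
  Δ-mate v = proj₁ (proj₂ (proj₂ (Δ-matching v refl)))

  mate-unique : ∀ {v w} → Δ N v w → w ≡ mate v
  mate-unique {v} {w} = proj₂ (proj₂ (proj₂ (Δ-matching v refl))) w refl

  mate-involutive : ∀ v → mate (mate v) ≡ v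
  mate-involutive v = sym (mate-unique (proj₁ Δ-undirected _ _ (Δ-mate v)))

  -- An edge between two mates would extend along the cycle to an induced path on
  -- four vertices.
  cycle⇒bimatching : ∀ {X} → Nonempty X → (∀ {v w} → v ∈ X → w ∈ X → ¬ E N v w) →
    (∀ v → v ∈ X → Uniquely X (λ u → E N u (mate v)) × Uniquely X (λ u → E N v (mate u))) →
    Σ (Fin n → Bool) (InducesBimatching N)
  cycle⇒bimatching {X} (root , root∈X) stable cyclic =
    W , (root-in-W , λ v v∈W → E-partner v (∈W⁻ v∈W))
      , (root-in-W , λ v v∈W → Δ-partner v (∈W⁻ v∈W))
    where
    R : Fin n → Fin n → Set
    R v u = E N u (mate v)

    -- The bimatching consists of `X` together with the mates of its vertices.
    ∈W? : ∀ v → Dec (v ∈ X ⊎ mate v ∈ X)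
    ∈W? v = (v ∈? X) ⊎-dec (mate v ∈? X)

    W : Fin n → Bool
    W v = does (∈W? v)

    ∈W⁺ : ∀ {v} → v ∈ X ⊎ mate v ∈ X → W v ≡ true
    ∈W⁺ = dec-true (∈W? _)

    ∈W⁻ : ∀ {v} → W v ≡ true → v ∈ X ⊎ mate v ∈ X
    ∈W⁻ {v} = does-true⁻ (∈W? v)

    mate∈W : ∀ {v} → v ∈ X → W (mate v) ≡ true
    mate∈W {v} v∈X = ∈W⁺ (inj₂ (subst (_∈ X) (sym (mate-involutive v)) v∈X))

    root-in-W : Σ (Fin n) λ v → W v ≡ true
    root-in-W = root , ∈W⁺ (inj₁ root∈X)

    successor : ∀ {v} → v ∈ X → Uniquely X (R v)
    successor v∈X = proj₁ (cyclic _ v∈X)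

    predecessor : ∀ {v} → v ∈ X → Uniquely X (λ u → R u v)
    predecessor v∈X = proj₂ (cyclic _ v∈X)

    Partner : (Fin n → Fin n → Set) → Fin n → Set
    Partner Q v = Σ (Fin n) λ w → W w ≡ true × Q v w ×
                    ((u : Fin n) → W u ≡ true → Q v u → u ≡ w)

    mates-not-adjacent : ∀ {y z} → y ∈ X → z ∈ X → ¬ E N (mate y) (mate z)
    mates-not-adjacent {y} {z} y∈X z∈X edge =
      -- The path runs from the successor of `y` through `mate y` and `mate z` to the successor of
      -- `z`. A chord at a mate would give one vertex the two predecessors `y` and `z`; the end
      -- points lie in the stable set `X`.
      P4-free Ry edge (E-sym Rz)
        (λ e → y≢z (unique-pred sy∈X y∈X z∈X Ry e))
        (λ e → y≢z (unique-pred sz∈X y∈X z∈X (E-sym e) Rz))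
        (stable sy∈X sz∈X)
      where
      y≢z : y ≢ z
      y≢z refl = proj₂ (proj₁ E-cograph) _ edge
      sy∈X = proj₁ (proj₂ (successor y∈X))
      Ry   = proj₁ (proj₂ (proj₂ (successor y∈X)))
      sz∈X = proj₁ (proj₂ (successor z∈X))
      Rz   = proj₁ (proj₂ (proj₂ (successor z∈X)))
      unique-pred : ∀ {s u v} → s ∈ X → u ∈ X → v ∈ X → R u s → R v s → u ≡ v
      unique-pred s∈X u∈X v∈X Rus Rvs =
        let _ , _ , _ , only = predecessor s∈X
        in trans (only _ u∈X Rus) (sym (only _ v∈X Rvs))

    -- The edges of the bimatching are the steps of the cycle: a vertex of `X` is matched with the
    -- mate of its predecessor, and the mate of a vertex of `X` with the successor of that vertex.
    E-partner : ∀ v → v ∈ X ⊎ mate v ∈ X → Partner (E N) v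
    E-partner v (inj₁ v∈X) =
      let u , u∈X , Ruv , only = predecessor v∈X
      in mate u , mate∈W u∈X , Ruv , λ w w∈W e → unique (∈W⁻ w∈W) e only
      where
      unique : ∀ {w u} → w ∈ X ⊎ mate w ∈ X → E N v w → (∀ y → y ∈ X → R y v → y ≡ u) → w ≡ mate u
      unique (inj₁ w∈X) e only = ⊥-elim (stable v∈X w∈X e)
      unique {w} (inj₂ mw∈X) e only = trans (sym (mate-involutive w)) (cong mate
        (only _ mw∈X (subst (E N v) (sym (mate-involutive w)) e)))
    E-partner v (inj₂ mv∈X) =
      let s , s∈X , Rmvs , only = successor mv∈X
      in s , ∈W⁺ (inj₁ s∈X) , E-sym (subst (E N s) (mate-involutive v) Rmvs)
           , λ w w∈W e → unique (∈W⁻ w∈W) e only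
      where
      unique : ∀ {w s} → w ∈ X ⊎ mate w ∈ X → E N v w →
               (∀ x → x ∈ X → R (mate v) x → x ≡ s) → w ≡ s
      unique {w} (inj₁ w∈X) e only =
        only _ w∈X (subst (E N w) (sym (mate-involutive v)) (E-sym e))
      unique {w} (inj₂ mw∈X) e only = ⊥-elim (mates-not-adjacent mv∈X mw∈X
        (subst₂ (E N) (sym (mate-involutive v)) (sym (mate-involutive w)) e))

    Δ-partner : ∀ v → v ∈ X ⊎ mate v ∈ X → Partner (Δ N) v
    Δ-partner v v∈ = mate v , mv∈W v∈ , Δ-mate v , λ u _ → mate-unique
      where
      mv∈W : v ∈ X ⊎ mate v ∈ X → W (mate v) ≡ true
      mv∈W (inj₁ v∈X)  = mate∈W v∈X
      mv∈W (inj₂ mv∈X) = ∈W⁺ (inj₁ mv∈X)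

  -- The negated hypothesis combines both properties in the name: in a dual-free set the mate of a
  -- member lies outside, so by maximality it has a neighbour inside. This is seriality of the step
  -- from a vertex to its mate and on to a neighbour.
  no-dual-free-maximal-stable : (∀ v w → Dec (E N v w)) → ∀ {T} → Nonempty T →
    (∀ {v w} → v ∈ T → w ∈ T → ¬ E N v w) →
    ¬ (∀ v → v ∈ T → ∃ λ u → u ∈ T × E N u (mate v))
  no-dual-free-maximal-stable E? nonempty stable serial =
    let X , X⊆T , ne , cyclic = chordless-cycle (λ v u → E? u (mate v)) nonempty serial
    in proj₁ (proj₂ net)
         (cycle⇒bimatching ne (λ v∈X w∈X → stable (X⊆T v∈X) (X⊆T w∈X)) cyclic)

-- Clauses of a falsified proposition

Conj-sym : ∀ {φ} {v w : Occ φ} → Conj v w → Conj w v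
Conj-sym lr = rl
Conj-sym rl = lr
Conj-sym (∧ll c) = ∧ll (Conj-sym c)
Conj-sym (∧rr c) = ∧rr (Conj-sym c)
Conj-sym (∨ll c) = ∨ll (Conj-sym c)
Conj-sym (∨rr c) = ∨rr (Conj-sym c)

-- The clause chosen by `ρ`. Preferring the left conjunct exactly when it is false makes the kept
-- conjunct of a false conjunction false again.
selected : (ℕ → Bool) → ∀ {φ} → Occ φ → Bool
selected ρ (here a) = true
selected ρ (∧l {φ} o) = and (not (eval ρ φ)) (selected ρ o)
selected ρ (∧r {φ} o) = and (eval ρ φ) (selected ρ o)
selected ρ (∨l o) = selected ρ o
selected ρ (∨r o) = selected ρ o

selected⇒false : ∀ ρ {φ} (o : Occ φ) → eval ρ φ ≡ false → selected ρ o ≡ true →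
                 evalAtom ρ (label o) ≡ false
selected⇒false ρ (here a) φ-false _ = φ-false
selected⇒false ρ (∧l {φ} o) φ-false s with eval ρ φ in eq
... | false = selected⇒false ρ o eq s
selected⇒false ρ (∧r {φ} o) φ-false s with eval ρ φ in eq
... | true = selected⇒false ρ o φ-false s
selected⇒false ρ (∨l {φ} o) φ-false s with eval ρ φ in eq
... | false = selected⇒false ρ o eq s
selected⇒false ρ (∨r {φ} o) φ-false s with eval ρ φ in eq
... | false = selected⇒false ρ o φ-false s

selected-stable : ∀ ρ {φ} {v w : Occ φ} → selected ρ v ≡ true → selected ρ w ≡ true → ¬ Conj v w
selected-stable ρ sv sw (lr {φ}) with eval ρ φ
selected-stable ρ () sw lr | true
selected-stable ρ sv () lr | false
selected-stable ρ sv sw (rl {φ}) with eval ρ φ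
selected-stable ρ sv () rl | true
selected-stable ρ () sw rl | false
selected-stable ρ sv sw (∧ll {φ} c) with eval ρ φ
... | false = selected-stable ρ sv sw c
selected-stable ρ sv sw (∧rr {φ} c) with eval ρ φ
... | true = selected-stable ρ sv sw c
selected-stable ρ sv sw (∨ll c) = selected-stable ρ sv sw c
selected-stable ρ sv sw (∨rr c) = selected-stable ρ sv sw c

selected-∧l : ∀ ρ {φ ψ} (o : Occ φ) → eval ρ φ ≡ false → selected ρ (∧l {φ} {ψ} o) ≡ selected ρ o
selected-∧l ρ o φ-false rewrite φ-false = refl

selected-∧r : ∀ ρ {φ ψ} (o : Occ ψ) → eval ρ φ ≡ true → selected ρ (∧r {φ} {ψ} o) ≡ selected ρ o
selected-∧r ρ o φ-true rewrite φ-true = refl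

evalAtom-dual : ∀ ρ a → evalAtom ρ a ≡ false → evalAtom ρ (dual a) ≢ false
evalAtom-dual ρ (pos n) eq eq′ with ρ n
evalAtom-dual ρ (pos n) () eq′ | true
evalAtom-dual ρ (pos n) eq () | false
evalAtom-dual ρ (neg n) eq eq′ with ρ n
evalAtom-dual ρ (neg n) eq () | true
evalAtom-dual ρ (neg n) () eq′ | false

-- The occurrences of a subformula form a module of the conjunction graph: every
-- outside occurrence is adjacent to all of them or to none.
record Subformula (φ ψ : Form) : Set where
  field
    embed : Occ ψ → Occ φ
    preserves : ∀ {a b} → Conj a b → Conj (embed a) (embed b)
    reflects : ∀ {a b} → Conj (embed a) (embed b) → Conj a b
    absorbs : ∀ {o a b} → Conj o (embed a) → ¬ Conj o (embed b) → ∃ λ c → o ≡ embed c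

module _ {φ : Form} where
  open Subformula

  whole : Subformula φ φ
  whole = record { embed = λ o → o ; preserves = λ c → c ; reflects = λ c → c
                 ; absorbs = λ _ _ → _ , refl }

  -- Modularity descends because an occurrence in the other conjunct is adjacent to everything in
  -- this one; for disjuncts, because it is adjacent to nothing in this one.
  left-conjunct : ∀ {ψ χ} → Subformula φ (ψ ∧ χ) → Subformula φ ψ
  left-conjunct {ψ} s = record
    { embed = embed s ∘ ∧l
    ; preserves = preserves s ∘ ∧ll
    ; reflects = λ c → case reflects s c of λ { (∧ll c) → c }
    ; absorbs = λ {o} {a} {b} e n → inside (absorbs s e n) n
    }
    where
    inside : ∀ {o} {b : Occ ψ} → (∃ λ c → o ≡ embed s c) → ¬ Conj o (embed s (∧l b)) →
             ∃ λ c → o ≡ embed s (∧l c)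
    inside (∧l c , eq) _ = c , eq
    inside (∧r c , refl) n = contradiction (preserves s rl) n

  right-conjunct : ∀ {ψ χ} → Subformula φ (ψ ∧ χ) → Subformula φ χ
  right-conjunct {ψ} {χ} s = record
    { embed = embed s ∘ ∧r
    ; preserves = preserves s ∘ ∧rr
    ; reflects = λ c → case reflects s c of λ { (∧rr c) → c }
    ; absorbs = λ e n → inside (absorbs s e n) n
    }
    where
    inside : ∀ {o} {b : Occ χ} → (∃ λ c → o ≡ embed s c) → ¬ Conj o (embed s (∧r b)) →
             ∃ λ c → o ≡ embed s (∧r c)
    inside (∧r c , eq) _ = c , eq
    inside (∧l c , refl) n = contradiction (preserves s lr) n

  left-disjunct : ∀ {ψ χ} → Subformula φ (ψ ∨ χ) → Subformula φ ψ
  left-disjunct {ψ} s = record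
    { embed = embed s ∘ ∨l
    ; preserves = preserves s ∘ ∨ll
    ; reflects = λ c → case reflects s c of λ { (∨ll c) → c }
    ; absorbs = λ e n → inside (absorbs s e n) e
    }
    where
    inside : ∀ {o} {a : Occ ψ} → (∃ λ c → o ≡ embed s c) → Conj o (embed s (∨l a)) →
             ∃ λ c → o ≡ embed s (∨l c)
    inside (∨l c , eq) _ = c , eq
    inside (∨r c , refl) e = case reflects s e of λ ()

  right-disjunct : ∀ {ψ χ} → Subformula φ (ψ ∨ χ) → Subformula φ χ
  right-disjunct {ψ} {χ} s = record
    { embed = embed s ∘ ∨r
    ; preserves = preserves s ∘ ∨rr
    ; reflects = λ c → case reflects s c of λ { (∨rr c) → c }
    ; absorbs = λ e n → inside (absorbs s e n) e
    }
    where
    inside : ∀ {o} {a : Occ χ} → (∃ λ c → o ≡ embed s c) → Conj o (embed s (∨r a)) →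
             ∃ λ c → o ≡ embed s (∨r c)
    inside (∨r c , eq) _ = c , eq
    inside (∨l c , refl) e = case reflects s e of λ ()

-- Preimages of clauses under a skew fibration

module _ {n} (N : BiGraph (Fin n)) (net : IsDualizingNet N)
         {φ : Form} (f : Fin n → Occ φ) (fib : IsSkewFibration N (𝒟 φ) f)
         (ρ : ℕ → Bool) where

  open Subformula

  private
    E-cograph = proj₁ (proj₂ (proj₁ net))

    E-sym : ∀ {v w} → E N v w → E N w v
    E-sym = proj₁ (proj₁ E-cograph) _ _

    hom : ∀ {v w} → E N v w → Conj (f v) (f w)
    hom = proj₁ fib _ _

    P4-free : ∀ {a b c d} → E N a b → E N b c → E N c d →
              ¬ E N a c → ¬ E N b d → ¬ E N a d → ⊥
    P4-free = proj₂ E-cograph _ _ _ _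

    skew : ∀ v w → Conj w (f v) → Σ (Fin n) λ u → E N u v × ¬ Conj (f u) w
    skew = proj₁ (proj₂ fib)

  NoSelectedNeighbour : ∀ {ψ} → Subformula φ ψ → Fin n → Set
  NoSelectedNeighbour s v = ∀ {u} → E N u v → ∀ {c} → f u ≡ embed s c → selected ρ c ≢ true

  inherit-∧l : ∀ {ψ χ} (s : Subformula φ (ψ ∧ χ)) {v} → eval ρ ψ ≡ false →
               NoSelectedNeighbour s v → NoSelectedNeighbour (left-conjunct s) v
  inherit-∧l {χ = χ} s ψ-false none e {c} eq sel =
    none e eq (trans (selected-∧l ρ {ψ = χ} c ψ-false) sel)

  inherit-∧r : ∀ {ψ χ} (s : Subformula φ (ψ ∧ χ)) {v} → eval ρ ψ ≡ true →
               NoSelectedNeighbour s v → NoSelectedNeighbour (right-conjunct s) v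
  inherit-∧r {ψ} s ψ-true none e {c} eq sel =
    none e eq (trans (selected-∧r ρ {φ = ψ} c ψ-true) sel)

  -- Such a `w` obstructs skewness: if `embed s w` is adjacent to `f v`, skewness asks for a
  -- neighbour of `v` whose image is not adjacent to it.
  Bounded : ∀ {ψ} → Subformula φ ψ → Fin n → Occ ψ → Set
  Bounded s v w = ∀ {u} → E N u v → ∀ {c} → f u ≡ embed s c → Conj c w

  -- The double negation stands for a case distinction on the undecidable E N.
  bound : ∀ {ψ} → Simple ψ → (s : Subformula φ ψ) → ∀ {v} →
          NoSelectedNeighbour s v → ¬ ¬ ∃ (Bounded s v)
  -- The only occurrence is selected, so no neighbour of `v` lies over the atom and the bound is
  -- vacuous.
  bound (atom a) s none k = k (here a , λ { e {here _} eq → contradiction refl (none e eq) })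
  -- A neighbour over the discarded conjunct is adjacent to everything in the kept one, so a bound
  -- for the kept conjunct suffices.
  bound (_∧_ {ψ} p q) s none k with eval ρ ψ in eq
  ... | false = bound p (left-conjunct s) (inherit-∧l s eq none)
    λ (w , b) → k (∧l w , λ { e {∧l c} eq′ → ∧ll (b e eq′) ; e {∧r c} eq′ → rl })
  ... | true = bound q (right-conjunct s) (inherit-∧r s eq none)
    λ (w , b) → k (∧r w , λ { e {∧r c} eq′ → ∧rr (b e eq′) ; e {∧l c} eq′ → lr })
  -- If v has neighbours a over the left and b over the right disjunct, then
  -- skewness at b against the right bound gives an induced path x, b, v, a.
  bound (p ∨ q) s {v} none k =
    bound p (left-disjunct s) (λ e eq → none e eq) λ (w₁ , b₁) →
    bound q (right-disjunct s) (λ e eq → none e eq) λ (w₂ , b₂) →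
    k (∨l w₁ , λ
      { av {∨l d} eqa → ∨ll (b₁ av eqa)
      ; bv {∨r c} eqb → ⊥-elim (k (∨r w₂ , λ
        { bv′ {∨r d} eqd → ∨rr (b₂ bv′ eqd)
        ; av {∨l d} eqa → ⊥-elim (path b₂ bv eqb av eqa) })) })
    where
    across : ∀ {c d} → ¬ Conj (embed s (∨r c)) (embed s (∨l d))
    across e with reflects s e
    ... | ()

    path : ∀ {a b w₂ c d} → Bounded (right-disjunct s) v w₂ →
           E N b v → f b ≡ embed s (∨r c) → E N a v → f a ≡ embed s (∨l d) → ⊥
    path {a} {b} {w₂} b₂ bv eqb av eqa =
      let x , xb , x≁w₂ = skew b (embed s (∨r w₂))
            (subst (Conj _) (sym eqb) (preserves s (∨rr (Conj-sym (b₂ bv eqb)))))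
          -- The image of `x` is adjacent to one occurrence of the right disjunct and not to
          -- another, so modularity places it inside. Hence `x` is not adjacent to `a`, and by the
          -- bound not to `v`.
          d , eqx = absorbs (right-disjunct s) (subst (Conj _) eqb (hom xb)) x≁w₂
      in P4-free xb bv (E-sym av)
           (λ xv → x≁w₂ (subst (λ o → Conj o _) (sym eqx) (preserves s (∨rr (b₂ xv eqx)))))
           (λ ba → across (subst₂ Conj eqb eqa (hom ba)))
           (λ xa → across (subst₂ Conj eqx eqa (hom xa)))

  -- Maximality of the preimage of the clause. Descend to the conjunction where `o` lies in the
  -- discarded conjunct and take a bound `w` in the kept one. Skewness at `v` against `w` yields a
  -- neighbour not adjacent to `w` in the image; modularity puts it over this conjunction, where
  -- every neighbour of `v` is adjacent to `w`.
  unselected⇒selected-neighbour : ∀ {ψ} → Simple ψ → (s : Subformula φ ψ) →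
    ∀ {v} o → f v ≡ embed s o → selected ρ o ≢ true → ¬ NoSelectedNeighbour s v
  unselected⇒selected-neighbour (atom a) s (here _) eqv ns none = ns refl
  unselected⇒selected-neighbour (_∧_ {ψ} p q) s {v} (∧l o) eqv ns none with eval ρ ψ in eq
  ... | false = unselected⇒selected-neighbour p (left-conjunct s) o eqv ns (inherit-∧l s eq none)
  ... | true = bound q (right-conjunct s) (inherit-∧r s eq none) λ (w , b) →
    let u , uv , u≁w = skew v (embed s (∧r w)) (subst (Conj _) (sym eqv) (preserves s rl))
    in case absorbs s (subst (Conj _) eqv (hom uv)) u≁w of λ
      { (∧l c , eqc) → u≁w (subst (λ o → Conj o _) (sym eqc) (preserves s lr))
      ; (∧r c , eqc) → u≁w (subst (λ o → Conj o _) (sym eqc) (preserves s (∧rr (b uv eqc)))) }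
  unselected⇒selected-neighbour (_∧_ {ψ} p q) s {v} (∧r o) eqv ns none with eval ρ ψ in eq
  ... | true = unselected⇒selected-neighbour q (right-conjunct s) o eqv ns (inherit-∧r s eq none)
  ... | false = bound p (left-conjunct s) (inherit-∧l s eq none) λ (w , b) →
    let u , uv , u≁w = skew v (embed s (∧l w)) (subst (Conj _) (sym eqv) (preserves s lr))
    in case absorbs s (subst (Conj _) eqv (hom uv)) u≁w of λ
      { (∧r c , eqc) → u≁w (subst (λ o → Conj o _) (sym eqc) (preserves s rl))
      ; (∧l c , eqc) → u≁w (subst (λ o → Conj o _) (sym eqc) (preserves s (∧ll (b uv eqc)))) }
  unselected⇒selected-neighbour (p ∨ q) s (∨l o) eqv ns none =
    unselected⇒selected-neighbour p (left-disjunct s) o eqv ns λ e eq → none e eq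
  unselected⇒selected-neighbour (p ∨ q) s (∨r o) eqv ns none =
    unselected⇒selected-neighbour q (right-disjunct s) o eqv ns λ e eq → none e eq

  not-falsified : Simple φ → eval ρ φ ≢ false
  not-falsified simple φ-false =
    -- The goal is a contradiction, so the finitely many instances of excluded middle for `E N` may
    -- be assumed together.
    sequence rawApplicative (λ v → sequence rawApplicative λ w → ¬¬-excluded-middle) λ E? →
    no-dual-free-maximal-stable N net E? (nonempty E?) (λ v∈T w∈T e → stable v∈T w∈T e)
      (λ v v∈T → neighbour E? (mate N net v) (dual-free v∈T))
    where
    open RawMonad (¬¬-Monad {a = 0ℓ}) using (rawApplicative)

    T : Subset n
    T = tabulate (selected ρ ∘ f)

    ∈T⁺ : ∀ {v} → selected ρ (f v) ≡ true → v ∈ T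
    ∈T⁺ {v} sel = lookup⇒[]= v T (trans (lookup∘tabulate _ v) sel)

    ∈T⁻ : ∀ {v} → v ∈ T → selected ρ (f v) ≡ true
    ∈T⁻ {v} v∈T = trans (sym (lookup∘tabulate _ v)) ([]=⇒lookup v∈T)

    stable : ∀ {v w} → v ∈ T → w ∈ T → ¬ E N v w
    stable v∈T w∈T e = selected-stable ρ (∈T⁻ v∈T) (∈T⁻ w∈T) (hom e)

    dual-free : ∀ {v} → v ∈ T → mate N net v ∉ T
    dual-free {v} v∈T mv∈T =
      evalAtom-dual ρ (label (f v)) (selected⇒false ρ (f v) φ-false (∈T⁻ v∈T))
        (trans (cong (evalAtom ρ) (proj₂ (proj₂ fib) _ _ (Δ-mate N net v)))
               (selected⇒false ρ (f (mate N net v)) φ-false (∈T⁻ mv∈T)))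

    neighbour : (∀ v w → Dec (E N v w)) → ∀ v → v ∉ T → ∃ λ u → u ∈ T × E N u v
    neighbour E? v v∉T = decidable-stable (any? (λ u → (u ∈? T) ×-dec E? u v)) λ none →
      unselected⇒selected-neighbour simple whole (f v) refl (v∉T ∘ ∈T⁺)
        λ { e refl sel → none (_ , ∈T⁺ sel , e) }

    nonempty : (∀ v w → Dec (E N v w)) → Nonempty T
    nonempty E? with proj₁ (proj₁ net) ∈? T
    ... | yes v∈T = _ , v∈T
    ... | no  v∉T = let u , u∈T , _ = neighbour E? _ v∉T in u , u∈T

soundness : ∀ {n} (N : BiGraph (Fin n)) → IsDualizingNet N → ∀ {φ} → Simple φ →
            (f : Fin n → Occ φ) → IsSkewFibration N (𝒟 φ) f → Valid φ
soundness N net simple f fib ρ = ¬-not (not-falsified N net f fib ρ simple)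

-- Nets over a proposition

-- The dualities are encoded as a fixed-point-free involution, which extends componentwise to
-- disjoint sums and makes the conditions on `Δ` automatic.
record MatchedCograph (V : Set) : Set₁ where
  field
    _~_ : V → V → Set
    ~-sym : ∀ {v w} → v ~ w → w ~ v
    ~-irrefl : ∀ {v} → ¬ v ~ v
    ~-P4-free : ∀ {a b c d} → a ~ b → b ~ c → c ~ d → ¬ a ~ c → ¬ b ~ d → ¬ a ~ d → ⊥
    partner : V → V
    partner-involutive : ∀ v → partner (partner v) ≡ v
    partner-apart : ∀ v → partner v ≢ v

  Isolated : (V → Bool) → V → Set
  Isolated W v = W v ≡ true × (∀ u → W u ≡ true → ¬ v ~ u)

  PartnerClosed : (V → Bool) → Set
  PartnerClosed W = ∀ v → W v ≡ true → W (partner v) ≡ true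

  DegreeAtMostOne : (V → Bool) → Set
  DegreeAtMostOne W = ∀ {v u w} → W v ≡ true → W u ≡ true → W w ≡ true → v ~ u → v ~ w → u ≡ w

-- Requiring two isolated vertices strengthens the absence of bimatchings to an
-- invariant that survives joining two nets along a conjunction.
record Cover (φ : Form) : Set₁ where
  field
    {V}    : Set
    {size} : ℕ
    finite : Fin size ↔ V
    root   : V
    graph  : MatchedCograph V
  open MatchedCograph graph public
  field
    two-isolated : ∀ W → (∃ λ v → W v ≡ true) → PartnerClosed W → DegreeAtMostOne W →
                   ∃₂ λ x y → x ≢ y × Isolated W x × Isolated W y
    f      : V → Occ φ
    f-hom  : ∀ {v w} → v ~ w → Conj (f v) (f w)
    f-skew : ∀ v w → Conj w (f v) → ∃ λ u → u ~ v × ¬ Conj (f u) w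
    f-dual : ∀ v → DualOcc (f v) (f (partner v))

  open Inverse finite using (to; from; strictlyInverseˡ)

  anyV? : {P : V → Set} → (∀ v → Dec (P v)) → Dec (∃ P)
  anyV? {P} P? = map′ (λ (i , p) → to i , p)
    (λ (v , p) → from v , subst P (sym (strictlyInverseˡ v)) p) (any? (P? ∘ to))

Cover⇒net : ∀ {φ} → Cover φ → Σ ℕ λ n → Σ (BiGraph (Fin n)) λ N →
            IsDualizingNet N × Σ (Fin n → Occ φ) λ f → IsSkewFibration N (𝒟 φ) f
Cover⇒net {φ} c = size , N ,
  ((from root
    , (((λ _ _ → ~-sym) , λ _ → ~-irrefl) , λ _ _ _ _ → ~-P4-free)
    , ((Δ-sym , Δ-irrefl) , λ _ _ _ d ab bc cd nac _ nad →
        nad (subst (λ i → Δ N i d) (sym (Δ-path ab bc)) cd))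
    , λ _ _ _ ab bc ac → Δ-irrefl _ (subst (Δ N _) (sym (Δ-path ab bc)) ac))
  , no-bimatching
  , ((from root , refl) , λ i _ → from (partner (to i)) , refl , sym (strictlyInverseˡ _)
      , λ j _ ij → trans (sym (strictlyInverseʳ j)) (cong from (sym ij))))
  , f ∘ to
  , (λ _ _ → f-hom)
  , (λ i w e → let u , u~v , n = f-skew (to i) w e
               in from u , subst (_~ to i) (sym (strictlyInverseˡ u)) u~v
                , subst (λ v → ¬ Conj (f v) w) (sym (strictlyInverseˡ u)) n)
  , λ i j ij → subst (λ v → DualOcc (f (to i)) (f v)) ij (f-dual (to i))
  where
  open Cover c
  open Inverse finite using (to; from; strictlyInverseˡ; strictlyInverseʳ)

  N : BiGraph (Fin size)
  N = record { E = λ i j → to i ~ to j ; Δ = λ i j → partner (to i) ≡ to j }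

  to-injective : ∀ {i j} → to i ≡ to j → i ≡ j
  to-injective eq = trans (sym (strictlyInverseʳ _)) (trans (cong from eq) (strictlyInverseʳ _))

  from-injective : ∀ {v w} → from v ≡ from w → v ≡ w
  from-injective eq = trans (sym (strictlyInverseˡ _)) (trans (cong to eq) (strictlyInverseˡ _))

  Δ-sym : ∀ i j → Δ N i j → Δ N j i
  Δ-sym i j ij = trans (cong partner (sym ij)) (partner-involutive (to i))

  Δ-irrefl : ∀ i → ¬ Δ N i i
  Δ-irrefl i = partner-apart (to i)

  -- Two consecutive dualities return to the start, which excludes both triangles and induced
  -- four-vertex paths.
  Δ-path : ∀ {i j k} → Δ N i j → Δ N j k → i ≡ k
  Δ-path ij jk = to-injective (trans (sym (partner-involutive _)) (trans (cong partner ij) jk))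

  -- A bimatching is closed under partners and has all degrees one, so it would contain an isolated
  -- vertex, which its edge matching forbids.
  no-bimatching : ¬ Σ (Fin size → Bool) (InducesBimatching N)
  no-bimatching (W , ((i , i∈W) , E-match) , (_ , Δ-match)) =
    let x , _ , _ , (x∈W , isolated) , _ = two-isolated W′ (to i , at-to i∈W) closed degree
        s , s∈W , xs , _ = E-match (from x) x∈W
    in isolated (to s) (at-to s∈W) (subst (_~ to s) (strictlyInverseˡ x) xs)
    where
    W′ : V → Bool
    W′ = W ∘ from

    at-to : ∀ {i} → W i ≡ true → W′ (to i) ≡ true
    at-to {i} = subst (λ j → W j ≡ true) (sym (strictlyInverseʳ i))

    closed : PartnerClosed W′
    closed v v∈W =
      let w , w∈W , vw , _ = Δ-match (from v) v∈W
      in subst (λ u → W′ u ≡ true) (trans (sym vw) (cong partner (strictlyInverseˡ v))) (at-to w∈W)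

    degree : DegreeAtMostOne W′
    degree {v} {u} {w} v∈W u∈W w∈W vu vw =
      let _ , _ , _ , only = E-match (from v) v∈W
      in from-injective (trans (only _ u∈W (back vu)) (sym (only _ w∈W (back vw))))
      where
      back : ∀ {u} → v ~ u → to (from v) ~ to (from u)
      back = subst₂ _~_ (sym (strictlyInverseˡ v)) (sym (strictlyInverseˡ _))

-- The last hypothesis replaces a target `w` by some `w′` in the source such that whatever avoids
-- `w′` also avoids `w`; skewness of `f` against `w′` then answers for `w`.
pushforward : ∀ {φ ψ} (c : Cover φ) (g : Occ φ → Occ ψ) →
  (∀ {a b} → Conj a b → Conj (g a) (g b)) → (∀ o → label (g o) ≡ label o) →
  (∀ v w → Conj w (g (Cover.f c v)) →
    ∃ λ w′ → Conj w′ (Cover.f c v) × (∀ o → Conj (g o) w → Conj o w′)) →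
  Cover ψ
pushforward c g g-hom g-label lift = record
  { finite = finite ; root = root ; graph = graph ; two-isolated = two-isolated
  ; f = g ∘ f
  ; f-hom = g-hom ∘ f-hom
  ; f-skew = λ v w e → let w′ , e′ , back = lift v w e
                           u , u~v , n = f-skew v w′ e′
                       in u , u~v , n ∘ back (f u)
  ; f-dual = λ v → trans (cong dual (g-label (f v)))
                     (trans (f-dual v) (sym (g-label (f (partner v)))))
  }
  where open Cover c

record _≅_ (φ ψ : Form) : Set where
  field
    to        : Occ φ → Occ ψ
    from      : Occ ψ → Occ φ
    to-from   : ∀ o → to (from o) ≡ o
    preserves : ∀ {a b} → Conj a b → Conj (to a) (to b)
    reflects : ∀ a b → Conj (to a) (to b) → Conj a b
    to-label  : ∀ o → label (to o) ≡ label o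

transport : ∀ {φ ψ} → φ ≅ ψ → Cover φ → Cover ψ
transport i c = pushforward c to preserves to-label λ v w e →
  from w , reflects _ _ (subst (λ o → Conj o _) (sym (to-from w)) e)
         , λ o e → reflects _ _ (subst (Conj _) (sym (to-from w)) e)
  where open _≅_ i

-- The rules of the sequent calculus

module _ {φ ψ : Form} where

  Left : Occ (φ ∨ ψ) → Set
  Left (∨l _) = ⊤
  Left (∨r _) = ⊥

  Left? : ∀ o → Dec (Left o)
  Left? (∨l _) = yes tt
  Left? (∨r _) = no λ ()

  Conj-Left : ∀ {v w} → Conj v w → Left v → Left w
  Conj-Left (∨ll _) _ = tt

Conj? : ∀ {φ} (v w : Occ φ) → Dec (Conj v w)
Conj? (here a) (here _) = no λ ()
Conj? (∧l v) (∧l w) = map′ ∧ll (λ { (∧ll c) → c }) (Conj? v w)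
Conj? (∧l v) (∧r w) = yes lr
Conj? (∧r v) (∧l w) = yes rl
Conj? (∧r v) (∧r w) = map′ ∧rr (λ { (∧rr c) → c }) (Conj? v w)
Conj? (∨l v) (∨l w) = map′ ∨ll (λ { (∨ll c) → c }) (Conj? v w)
Conj? (∨l v) (∨r w) = no λ ()
Conj? (∨r v) (∨l w) = no λ ()
Conj? (∨r v) (∨r w) = map′ ∨rr (λ { (∨rr c) → c }) (Conj? v w)

module _ {φ ψ χ : Form} where

  conjoinˡ : Occ (φ ∨ χ) → Occ ((φ ∧ ψ) ∨ χ)
  conjoinˡ (∨l o) = ∨l (∧l o)
  conjoinˡ (∨r o) = ∨r o

  conjoinʳ : Occ (ψ ∨ χ) → Occ ((φ ∧ ψ) ∨ χ)
  conjoinʳ (∨l o) = ∨l (∧r o)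
  conjoinʳ (∨r o) = ∨r o

  conjoinˡ-preserves : ∀ {a b} → Conj a b → Conj (conjoinˡ a) (conjoinˡ b)
  conjoinˡ-preserves (∨ll c) = ∨ll (∧ll c)
  conjoinˡ-preserves (∨rr c) = ∨rr c

  conjoinʳ-preserves : ∀ {a b} → Conj a b → Conj (conjoinʳ a) (conjoinʳ b)
  conjoinʳ-preserves (∨ll c) = ∨ll (∧rr c)
  conjoinʳ-preserves (∨rr c) = ∨rr c

  conjoinˡ-reflects : ∀ a b → Conj (conjoinˡ a) (conjoinˡ b) → Conj a b
  conjoinˡ-reflects (∨l _) (∨l _) (∨ll (∧ll c)) = ∨ll c
  conjoinˡ-reflects (∨r _) (∨r _) (∨rr c) = ∨rr c

  conjoinʳ-reflects : ∀ a b → Conj (conjoinʳ a) (conjoinʳ b) → Conj a b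
  conjoinʳ-reflects (∨l _) (∨l _) (∨ll (∧rr c)) = ∨ll c
  conjoinʳ-reflects (∨r _) (∨r _) (∨rr c) = ∨rr c

  conjoinˡ-label : ∀ o → label (conjoinˡ o) ≡ label o
  conjoinˡ-label (∨l _) = refl
  conjoinˡ-label (∨r _) = refl

  conjoinʳ-label : ∀ o → label (conjoinʳ o) ≡ label o
  conjoinʳ-label (∨l _) = refl
  conjoinʳ-label (∨r _) = refl

  conjoinˡ-neighbour : ∀ o w → Conj w (conjoinˡ o) →
    (∃ λ a → w ≡ conjoinˡ a) ⊎ (Left o × ∃ λ b → w ≡ conjoinʳ (∨l b))
  conjoinˡ-neighbour (∨l _) (∨l (∧l a)) _ = inj₁ (∨l a , refl)
  conjoinˡ-neighbour (∨l _) (∨l (∧r b)) _ = inj₂ (tt , b , refl)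
  conjoinˡ-neighbour (∨r _) (∨r x) _ = inj₁ (∨r x , refl)

  conjoinʳ-neighbour : ∀ o w → Conj w (conjoinʳ o) →
    (∃ λ b → w ≡ conjoinʳ b) ⊎ (Left o × ∃ λ a → w ≡ conjoinˡ (∨l a))
  conjoinʳ-neighbour (∨l _) (∨l (∧r b)) _ = inj₁ (∨l b , refl)
  conjoinʳ-neighbour (∨l _) (∨l (∧l a)) _ = inj₂ (tt , a , refl)
  conjoinʳ-neighbour (∨r _) (∨r x) _ = inj₁ (∨r x , refl)

  conjoin-adjacent : ∀ {o o′} → Left o → Left o′ → Conj (conjoinˡ o) (conjoinʳ o′)
  conjoin-adjacent {∨l _} {∨l _} _ _ = ∨ll lr

  -- The added occurrences of `ψ` are adjacent only to those of `φ`, over which there are no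
  -- vertices, so skewness demands nothing new.
  weakenˡ : (c : Cover (φ ∨ χ)) → (∀ v → ¬ Left (Cover.f c v)) → Cover ((φ ∧ ψ) ∨ χ)
  weakenˡ c none = pushforward c conjoinˡ conjoinˡ-preserves conjoinˡ-label λ v w e →
    case conjoinˡ-neighbour _ w e of λ
      { (inj₁ (a , refl)) → a , conjoinˡ-reflects _ _ e , λ o → conjoinˡ-reflects _ _
      ; (inj₂ (l , _)) → contradiction l (none v) }

  weakenʳ : (c : Cover (ψ ∨ χ)) → (∀ v → ¬ Left (Cover.f c v)) → Cover ((φ ∧ ψ) ∨ χ)
  weakenʳ c none = pushforward c conjoinʳ conjoinʳ-preserves conjoinʳ-label λ v w e →
    case conjoinʳ-neighbour _ w e of λ
      { (inj₁ (b , refl)) → b , conjoinʳ-reflects _ _ e , λ o → conjoinʳ-reflects _ _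
      ; (inj₂ (l , _)) → contradiction l (none v) }

-- Either `v` itself avoids `a`, or skewness at `v` supplies a neighbour that does, and edges never
-- leave a disjunct.
skew-left : ∀ {φ χ} (c : Cover (φ ∨ χ)) {v} → Left (Cover.f c v) → ∀ a →
            ∃ λ u → Left (Cover.f c u) × ¬ Conj (Cover.f c u) (∨l a)
skew-left c {v} l a with Conj? (Cover.f c v) (∨l a)
... | no  n = v , l , n
... | yes e = let u , u~v , n = f-skew v (∨l a) (Conj-sym e)
              in u , Conj-Left (f-hom (~-sym u~v)) l , n
  where open Cover c

-- The join of two nets along a conjunction

module Join {φ ψ χ : Form} (c₁ : Cover (φ ∨ χ)) (c₂ : Cover (ψ ∨ χ)) where
  private
    module C₁ = Cover c₁
    module C₂ = Cover c₂

    L₁ : C₁.V → Set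
    L₁ v = Left (C₁.f v)

    L₂ : C₂.V → Set
    L₂ v = Left (C₂.f v)

    spread₁ : ∀ {v w} → v C₁.~ w → L₁ v → L₁ w
    spread₁ = Conj-Left ∘ C₁.f-hom

    spread₂ : ∀ {v w} → v C₂.~ w → L₂ v → L₂ w
    spread₂ = Conj-Left ∘ C₂.f-hom

    Vertex : Set
    Vertex = C₁.V ⊎ C₂.V

  Adjacent : Vertex → Vertex → Set
  Adjacent (inj₁ v) (inj₁ w) = v C₁.~ w
  Adjacent (inj₁ v) (inj₂ w) = L₁ v × L₂ w
  Adjacent (inj₂ v) (inj₁ w) = L₂ v × L₁ w
  Adjacent (inj₂ v) (inj₂ w) = v C₂.~ w

  Adjacent-sym : ∀ {v w} → Adjacent v w → Adjacent w v
  Adjacent-sym {inj₁ _} {inj₁ _} e = C₁.~-sym e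
  Adjacent-sym {inj₁ _} {inj₂ _} (l , r) = r , l
  Adjacent-sym {inj₂ _} {inj₁ _} (l , r) = r , l
  Adjacent-sym {inj₂ _} {inj₂ _} e = C₂.~-sym e

  Adjacent-irrefl : ∀ {v} → ¬ Adjacent v v
  Adjacent-irrefl {inj₁ _} = C₁.~-irrefl
  Adjacent-irrefl {inj₂ _} = C₂.~-irrefl

  -- Edges within one net preserve lying over the conjunct. In a path meeting both nets, the ends of
  -- a crossing edge pass this property to their neighbours on the path, which yields a chord
  -- between the two nets.
  Adjacent-P4-free : ∀ {a b c d} → Adjacent a b → Adjacent b c → Adjacent c d →
                     ¬ Adjacent a c → ¬ Adjacent b d → ¬ Adjacent a d → ⊥
  Adjacent-P4-free {inj₁ _} {inj₁ _} {inj₁ _} {inj₁ _} = C₁.~-P4-free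
  Adjacent-P4-free {inj₁ _} {inj₁ _} {inj₁ _} {inj₂ _} _ bc (lc , ld) _ nbd _ = nbd (spread₁ (C₁.~-sym bc) lc , ld)
  Adjacent-P4-free {inj₁ _} {inj₁ _} {inj₂ _} ab (lb , lc) _ nac _ _ = nac (spread₁ (C₁.~-sym ab) lb , lc)
  Adjacent-P4-free {inj₁ _} {inj₂ _} {inj₁ _} {inj₁ _} _ (lb , lc) cd _ nbd _ = nbd (lb , spread₁ cd lc)
  Adjacent-P4-free {inj₁ _} {inj₂ _} {inj₁ _} {inj₂ _} (la , _) _ (_ , ld) _ _ nad = nad (la , ld)
  Adjacent-P4-free {inj₁ _} {inj₂ _} {inj₂ _} (la , lb) bc _ nac _ _ = nac (la , spread₂ bc lb)
  Adjacent-P4-free {inj₂ _} {inj₁ _} {inj₁ _} (la , lb) bc _ nac _ _ = nac (la , spread₁ bc lb)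
  Adjacent-P4-free {inj₂ _} {inj₁ _} {inj₂ _} {inj₁ _} (la , _) _ (_ , ld) _ _ nad = nad (la , ld)
  Adjacent-P4-free {inj₂ _} {inj₁ _} {inj₂ _} {inj₂ _} _ (lb , lc) cd _ nbd _ = nbd (lb , spread₂ cd lc)
  Adjacent-P4-free {inj₂ _} {inj₂ _} {inj₁ _} ab (lb , lc) _ nac _ _ = nac (spread₂ (C₂.~-sym ab) lb , lc)
  Adjacent-P4-free {inj₂ _} {inj₂ _} {inj₂ _} {inj₁ _} _ bc (lc , ld) _ nbd _ = nbd (spread₂ (C₂.~-sym bc) lc , ld)
  Adjacent-P4-free {inj₂ _} {inj₂ _} {inj₂ _} {inj₂ _} = C₂.~-P4-free

  joint-graph : MatchedCograph Vertex
  joint-graph = record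
    { _~_ = Adjacent
    ; ~-sym = λ {v} {w} → Adjacent-sym {v} {w}
    ; ~-irrefl = λ {v} → Adjacent-irrefl {v}
    ; ~-P4-free = λ {a} {b} {c} {d} → Adjacent-P4-free {a} {b} {c} {d}
    ; partner = map C₁.partner C₂.partner
    ; partner-involutive = [ cong inj₁ ∘ C₁.partner-involutive , cong inj₂ ∘ C₂.partner-involutive ]
    ; partner-apart = [ (λ v → C₁.partner-apart v ∘ inj₁-injective)
                   , (λ v → C₂.partner-apart v ∘ inj₂-injective) ]
    }

  open MatchedCograph joint-graph using (Isolated; PartnerClosed; DegreeAtMostOne)

  module _ (W : Vertex → Bool) where

    -- Only a vertex over the conjunct can acquire new neighbours, and two such
    -- vertices would both be adjacent to any new neighbour.
    isolated₁ : DegreeAtMostOne W → ∀ {x y} → x ≢ y →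
                C₁.Isolated (W ∘ inj₁) x → C₁.Isolated (W ∘ inj₁) y → ∃ λ v → Isolated W (inj₁ v)
    isolated₁ degree {x} {y} x≢y (x∈W , x-isolated) (y∈W , y-isolated)
      with Left? (C₁.f x) | Left? (C₁.f y)
    ... | no ¬l | _ = x , x∈W , λ { (inj₁ u) → x-isolated u ; (inj₂ u) _ (l , _) → ¬l l }
    ... | yes _ | no ¬l = y , y∈W , λ { (inj₁ u) → y-isolated u ; (inj₂ u) _ (l , _) → ¬l l }
    ... | yes lx | yes ly = x , x∈W , λ
      { (inj₁ u) → x-isolated u
      ; (inj₂ u) u∈W (_ , lu) → x≢y (inj₁-injective
          (degree {inj₂ u} {inj₁ x} {inj₁ y} u∈W x∈W y∈W (lu , lx) (lu , ly))) }

    isolated₂ : DegreeAtMostOne W → ∀ {x y} → x ≢ y →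
                C₂.Isolated (W ∘ inj₂) x → C₂.Isolated (W ∘ inj₂) y → ∃ λ v → Isolated W (inj₂ v)
    isolated₂ degree {x} {y} x≢y (x∈W , x-isolated) (y∈W , y-isolated)
      with Left? (C₂.f x) | Left? (C₂.f y)
    ... | no ¬l | _ = x , x∈W , λ { (inj₂ u) → x-isolated u ; (inj₁ u) _ (l , _) → ¬l l }
    ... | yes _ | no ¬l = y , y∈W , λ { (inj₂ u) → y-isolated u ; (inj₁ u) _ (l , _) → ¬l l }
    ... | yes lx | yes ly = x , x∈W , λ
      { (inj₂ u) → x-isolated u
      ; (inj₁ u) u∈W (_ , lu) → x≢y (inj₂-injective
          (degree {inj₁ u} {inj₂ x} {inj₂ y} u∈W x∈W y∈W (lu , lx) (lu , ly))) }

    -- If `W` meets both nets, one isolated vertex survives on each side; if it meets only one, both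
    -- isolated vertices there stay isolated.
    joint-two-isolated : (∃ λ v → W v ≡ true) → PartnerClosed W → DegreeAtMostOne W →
                         ∃₂ λ x y → x ≢ y × Isolated W x × Isolated W y
    joint-two-isolated nonempty closed degree =
      by-cases (C₁.anyV? (λ v → W (inj₁ v) ≟ᵇ true)) (C₂.anyV? (λ v → W (inj₂ v) ≟ᵇ true))
      where
      two₁ : (∃ λ v → W (inj₁ v) ≡ true) →
             ∃₂ λ x y → x ≢ y × C₁.Isolated (W ∘ inj₁) x × C₁.Isolated (W ∘ inj₁) y
      two₁ ne = C₁.two-isolated (W ∘ inj₁) ne (closed ∘ inj₁) λ v∈W u∈W w∈W vu vw →
        inj₁-injective (degree {inj₁ _} {inj₁ _} {inj₁ _} v∈W u∈W w∈W vu vw)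

      two₂ : (∃ λ v → W (inj₂ v) ≡ true) →
             ∃₂ λ x y → x ≢ y × C₂.Isolated (W ∘ inj₂) x × C₂.Isolated (W ∘ inj₂) y
      two₂ ne = C₂.two-isolated (W ∘ inj₂) ne (closed ∘ inj₂) λ v∈W u∈W w∈W vu vw →
        inj₂-injective (degree {inj₂ _} {inj₂ _} {inj₂ _} v∈W u∈W w∈W vu vw)

      by-cases : Dec (∃ λ v → W (inj₁ v) ≡ true) → Dec (∃ λ v → W (inj₂ v) ≡ true) →
                 ∃₂ λ x y → x ≢ y × Isolated W x × Isolated W y
      by-cases (yes ne₁) (yes ne₂) =
        let _ , _ , x₁≢y₁ , x₁ , y₁ = two₁ ne₁
            _ , _ , x₂≢y₂ , x₂ , y₂ = two₂ ne₂
            u , u-isolated = isolated₁ degree x₁≢y₁ x₁ y₁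
            v , v-isolated = isolated₂ degree x₂≢y₂ x₂ y₂
        in inj₁ u , inj₂ v , (λ ()) , u-isolated , v-isolated
      by-cases (yes ne₁) (no none₂) =
        let x , y , x≢y , (x∈W , x-isolated) , (y∈W , y-isolated) = two₁ ne₁
        in inj₁ x , inj₁ y , x≢y ∘ inj₁-injective
             , (x∈W , [ x-isolated , (λ u u∈W → ⊥-elim (none₂ (u , u∈W))) ])
             , (y∈W , [ y-isolated , (λ u u∈W → ⊥-elim (none₂ (u , u∈W))) ])
      by-cases (no none₁) (yes ne₂) =
        let x , y , x≢y , (x∈W , x-isolated) , (y∈W , y-isolated) = two₂ ne₂
        in inj₂ x , inj₂ y , x≢y ∘ inj₂-injective
             , (x∈W , [ (λ u u∈W → ⊥-elim (none₁ (u , u∈W))) , x-isolated ])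
             , (y∈W , [ (λ u u∈W → ⊥-elim (none₁ (u , u∈W))) , y-isolated ])
      by-cases (no none₁) (no none₂) = case nonempty of λ
        { (inj₁ v , v∈W) → contradiction (v , v∈W) none₁
        ; (inj₂ v , v∈W) → contradiction (v , v∈W) none₂ }

  joint-f : Vertex → Occ ((φ ∧ ψ) ∨ χ)
  joint-f = [ conjoinˡ ∘ C₁.f , conjoinʳ ∘ C₂.f ]

  joint-hom : ∀ {v w} → Adjacent v w → Conj (joint-f v) (joint-f w)
  joint-hom {inj₁ _} {inj₁ _} e = conjoinˡ-preserves (C₁.f-hom e)
  joint-hom {inj₁ _} {inj₂ _} (l , r) = conjoin-adjacent l r
  joint-hom {inj₂ _} {inj₁ _} (l , r) = Conj-sym (conjoin-adjacent r l)
  joint-hom {inj₂ _} {inj₂ _} e = conjoinʳ-preserves (C₂.f-hom e)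

  join : ∃ L₁ → ∃ L₂ → Cover ((φ ∧ ψ) ∨ χ)
  join (v₁ , l₁) (v₂ , l₂) = record
    { finite = ↔-trans +↔⊎ (C₁.finite ⊎-↔ C₂.finite)
    ; root = inj₁ v₁
    ; graph = joint-graph
    ; two-isolated = joint-two-isolated
    ; f = joint-f
    ; f-hom = λ {v} {w} → joint-hom {v} {w}
    ; f-skew = joint-skew
    ; f-dual = [ dual₁ , dual₂ ]
    }
    where
    joint-skew : ∀ v w → Conj w (joint-f v) → ∃ λ u → Adjacent u v × ¬ Conj (joint-f u) w
    joint-skew (inj₁ v) w e with conjoinˡ-neighbour (C₁.f v) w e
    ... | inj₁ (a , refl) =
      let u , u~v , n = C₁.f-skew v a (conjoinˡ-reflects _ _ e)
      in inj₁ u , u~v , n ∘ conjoinˡ-reflects _ _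
    -- Here `w` lies in the other conjunct. The answer is a vertex of the other net over that
    -- conjunct avoiding `w`; the join makes it adjacent to `v`.
    ... | inj₂ (l , b , refl) =
      let u , l′ , n = skew-left c₂ l₂ b in inj₂ u , (l′ , l) , n ∘ conjoinʳ-reflects _ _
    joint-skew (inj₂ v) w e with conjoinʳ-neighbour (C₂.f v) w e
    ... | inj₁ (b , refl) =
      let u , u~v , n = C₂.f-skew v b (conjoinʳ-reflects _ _ e)
      in inj₂ u , u~v , n ∘ conjoinʳ-reflects _ _
    ... | inj₂ (l , a , refl) =
      let u , l′ , n = skew-left c₁ l₁ a in inj₁ u , (l′ , l) , n ∘ conjoinˡ-reflects _ _

    dual₁ : ∀ v → DualOcc (conjoinˡ {ψ = ψ} (C₁.f v)) (conjoinˡ {ψ = ψ} (C₁.f (C₁.partner v)))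
    dual₁ v = trans (cong dual (conjoinˡ-label (C₁.f v)))
      (trans (C₁.f-dual v) (sym (conjoinˡ-label (C₁.f (C₁.partner v)))))

    dual₂ : ∀ v → DualOcc (conjoinʳ {φ = φ} (C₂.f v)) (conjoinʳ {φ = φ} (C₂.f (C₂.partner v)))
    dual₂ v = trans (cong dual (conjoinʳ-label (C₂.f v)))
      (trans (C₂.f-dual v) (sym (conjoinʳ-label (C₂.f (C₂.partner v)))))

conjunction : ∀ {φ ψ χ} → Cover (φ ∨ χ) → Cover (ψ ∨ χ) → Cover ((φ ∧ ψ) ∨ χ)
conjunction c₁ c₂
  with Cover.anyV? c₁ (Left? ∘ Cover.f c₁) | Cover.anyV? c₂ (Left? ∘ Cover.f c₂)
... | no none | _       = weakenˡ c₁ (λ v l → none (v , l))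
... | yes _   | no none = weakenʳ c₂ (λ v l → none (v , l))
... | yes l₁  | yes l₂  = Join.join c₁ c₂ l₁ l₂

DualOcc-sym : ∀ {φ} {v w : Occ φ} → DualOcc v w → DualOcc w v
DualOcc-sym {v = v} eq = trans (cong dual (sym eq)) (dual-involutive (label v))
  where
  dual-involutive : ∀ a → dual (dual a) ≡ a
  dual-involutive (pos n) = refl
  dual-involutive (neg n) = refl

-- Without edges skewness is vacuous, and any vertex of a partner-closed set is isolated together
-- with its partner.
axiom : ∀ {φ} → (∀ (v w : Occ φ) → ¬ Conj v w) → (o o′ : Occ φ) → DualOcc o o′ → Cover φ
axiom edgeless o o′ dual = record
  { finite = 2↔Bool
  ; root = true
  ; graph = record
    { _~_ = λ _ _ → ⊥ ; ~-sym = λ () ; ~-irrefl = λ () ; ~-P4-free = λ ()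
    ; partner = not ; partner-involutive = not-involutive ; partner-apart = λ { true () ; false () } }
  ; two-isolated = λ W (v , v∈W) closed _ →
      v , not v , not-¬ refl , (v∈W , λ _ _ ()) , (closed v v∈W , λ _ _ ())
  ; f = λ { true → o ; false → o′ }
  ; f-hom = λ ()
  ; f-skew = λ _ w e → contradiction e (edgeless w _)
  ; f-dual = λ { true → dual ; false → DualOcc-sym {v = o} {o′} dual }
  }

-- Rearranging disjunctions

∨-assocʳ : ∀ {φ ψ χ} → ((φ ∨ ψ) ∨ χ) ≅ (ψ ∨ (φ ∨ χ))
∨-assocʳ = record
  { to = λ { (∨l (∨l o)) → ∨r (∨l o) ; (∨l (∨r o)) → ∨l o ; (∨r o) → ∨r (∨r o) }
  ; from = λ { (∨r (∨l o)) → ∨l (∨l o) ; (∨l o) → ∨l (∨r o) ; (∨r (∨r o)) → ∨r o }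
  ; to-from = λ { (∨l o) → refl ; (∨r (∨l o)) → refl ; (∨r (∨r o)) → refl }
  ; preserves = λ { (∨ll (∨ll c)) → ∨rr (∨ll c) ; (∨ll (∨rr c)) → ∨ll c ; (∨rr c) → ∨rr (∨rr c) }
  ; reflects = λ
    { (∨l (∨l _)) (∨l (∨l _)) (∨rr (∨ll c)) → ∨ll (∨ll c)
    ; (∨l (∨r _)) (∨l (∨r _)) (∨ll c) → ∨ll (∨rr c)
    ; (∨r _) (∨r _) (∨rr (∨rr c)) → ∨rr c
    ; (∨l (∨l _)) (∨r _) (∨rr ())
    ; (∨r _) (∨l (∨l _)) (∨rr ()) }
  ; to-label = λ { (∨l (∨l o)) → refl ; (∨l (∨r o)) → refl ; (∨r o) → refl }
  }

∨-assocˡ : ∀ {φ ψ χ} → (φ ∨ (ψ ∨ χ)) ≅ ((φ ∨ ψ) ∨ χ)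
∨-assocˡ = record
  { to = λ { (∨l o) → ∨l (∨l o) ; (∨r (∨l o)) → ∨l (∨r o) ; (∨r (∨r o)) → ∨r o }
  ; from = λ { (∨l (∨l o)) → ∨l o ; (∨l (∨r o)) → ∨r (∨l o) ; (∨r o) → ∨r (∨r o) }
  ; to-from = λ { (∨l (∨l o)) → refl ; (∨l (∨r o)) → refl ; (∨r o) → refl }
  ; preserves = λ { (∨ll c) → ∨ll (∨ll c) ; (∨rr (∨ll c)) → ∨ll (∨rr c) ; (∨rr (∨rr c)) → ∨rr c }
  ; reflects = λ
    { (∨l _) (∨l _) (∨ll (∨ll c)) → ∨ll c
    ; (∨r (∨l _)) (∨r (∨l _)) (∨ll (∨rr c)) → ∨rr (∨ll c)
    ; (∨r (∨r _)) (∨r (∨r _)) (∨rr c) → ∨rr (∨rr c)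
    ; (∨l _) (∨r (∨l _)) (∨ll ())
    ; (∨r (∨l _)) (∨l _) (∨ll ()) }
  ; to-label = λ { (∨l o) → refl ; (∨r (∨l o)) → refl ; (∨r (∨r o)) → refl }
  }

∨-exchange : ∀ {φ ψ χ} → (φ ∨ (ψ ∨ χ)) ≅ (ψ ∨ (φ ∨ χ))
∨-exchange = record
  { to = λ { (∨l o) → ∨r (∨l o) ; (∨r (∨l o)) → ∨l o ; (∨r (∨r o)) → ∨r (∨r o) }
  ; from = λ { (∨l o) → ∨r (∨l o) ; (∨r (∨l o)) → ∨l o ; (∨r (∨r o)) → ∨r (∨r o) }
  ; to-from = λ { (∨l o) → refl ; (∨r (∨l o)) → refl ; (∨r (∨r o)) → refl }
  ; preserves = λ { (∨ll c) → ∨rr (∨ll c) ; (∨rr (∨ll c)) → ∨ll c ; (∨rr (∨rr c)) → ∨rr (∨rr c) }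
  ; reflects = λ
    { (∨l _) (∨l _) (∨rr (∨ll c)) → ∨ll c
    ; (∨r (∨l _)) (∨r (∨l _)) (∨ll c) → ∨rr (∨ll c)
    ; (∨r (∨r _)) (∨r (∨r _)) (∨rr (∨rr c)) → ∨rr (∨rr c)
    ; (∨l _) (∨r (∨r _)) (∨rr ())
    ; (∨r (∨r _)) (∨l _) (∨rr ()) }
  ; to-label = λ { (∨l o) → refl ; (∨r (∨l o)) → refl ; (∨r (∨r o)) → refl }
  }

∨-identityʳ : ∀ {φ} → (φ ∨ 𝟘) ≅ φ
∨-identityʳ = record
  { to = λ { (∨l o) → o }
  ; from = ∨l
  ; to-from = λ _ → refl
  ; preserves = λ { (∨ll c) → c }
  ; reflects = λ { (∨l _) (∨l _) c → ∨ll c }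
  ; to-label = λ { (∨l o) → refl }
  }

-- Clauses and completeness

-- The conjuncts of the conjunctive normal form obtained by distribution, kept as disjunctions
-- shaped like the proposition.
data _ClauseOf_ : Form → Form → Set where
  atom : ∀ a → atom a ClauseOf atom a
  ∧l   : ∀ {κ φ ψ} → κ ClauseOf φ → κ ClauseOf (φ ∧ ψ)
  ∧r   : ∀ {κ φ ψ} → κ ClauseOf ψ → κ ClauseOf (φ ∧ ψ)
  _∨_  : ∀ {κ μ φ ψ} → κ ClauseOf φ → μ ClauseOf ψ → (κ ∨ μ) ClauseOf (φ ∨ ψ)

-- The context `χ` makes the induction work: at a disjunction one disjunct waits in the context
-- while the other is resolved into its clauses, and then the roles are exchanged.
cover-clauses : ∀ {φ} → Simple φ → ∀ {χ} → (∀ {κ} → κ ClauseOf φ → Cover (κ ∨ χ)) → Cover (φ ∨ χ)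
cover-clauses (atom a) cover = cover (atom a)
cover-clauses (p ∧ q) cover =
  conjunction (cover-clauses p (cover ∘ ∧l)) (cover-clauses q (cover ∘ ∧r))
cover-clauses (p ∨ q) cover =
  transport ∨-assocˡ (cover-clauses p λ k →
    transport ∨-exchange (cover-clauses q λ l →
      transport ∨-assocʳ (cover (k ∨ l))))

clause-edgeless : ∀ {κ φ} → κ ClauseOf φ → (v w : Occ κ) → ¬ Conj v w
clause-edgeless (atom a) _ _ ()
clause-edgeless (∧l k) v w c = clause-edgeless k v w c
clause-edgeless (∧r k) v w c = clause-edgeless k v w c
clause-edgeless (k ∨ l) _ _ (∨ll c) = clause-edgeless k _ _ c
clause-edgeless (k ∨ l) _ _ (∨rr c) = clause-edgeless l _ _ c

clause-true : ∀ {κ φ} ρ → κ ClauseOf φ → eval ρ φ ≡ true →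
              ∃ λ (o : Occ κ) → evalAtom ρ (label o) ≡ true
clause-true ρ (atom a) φ-true = here a , φ-true
clause-true ρ (∧l {φ = φ} k) φ-true with eval ρ φ in eq
... | true = clause-true ρ k eq
clause-true ρ (∧r {φ = φ} k) φ-true with eval ρ φ
... | true = clause-true ρ k φ-true
clause-true ρ (_∨_ {φ = φ} k l) φ-true with eval ρ φ in eq
... | true  = let o , o-true = clause-true ρ k eq in ∨l o , o-true
... | false = let o , o-true = clause-true ρ l φ-true in ∨r o , o-true

_≟ᵃ_ : (a b : Atom) → Dec (a ≡ b)
pos m ≟ᵃ pos n = map′ (cong pos) (λ { refl → refl }) (m ≟ⁿ n)
pos m ≟ᵃ neg n = no λ ()
neg m ≟ᵃ pos n = no λ ()
neg m ≟ᵃ neg n = map′ (cong neg) (λ { refl → refl }) (m ≟ⁿ n)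

occurs? : ∀ a κ → Dec (∃ λ (o : Occ κ) → label o ≡ a)
occurs? a (atom b) = map′ (here b ,_) (λ { (here _ , eq) → eq }) (b ≟ᵃ a)
occurs? a 𝟙 = no λ ()
occurs? a 𝟘 = no λ ()
occurs? a (κ ∧ μ) = map′
  [ (λ (o , eq) → ∧l o , eq) , (λ (o , eq) → ∧r o , eq) ]
  (λ { (∧l o , eq) → inj₁ (o , eq) ; (∧r o , eq) → inj₂ (o , eq) })
  (occurs? a κ ⊎-dec occurs? a μ)
occurs? a (κ ∨ μ) = map′
  [ (λ (o , eq) → ∨l o , eq) , (λ (o , eq) → ∨r o , eq) ]
  (λ { (∨l o , eq) → inj₁ (o , eq) ; (∨r o , eq) → inj₂ (o , eq) })
  (occurs? a κ ⊎-dec occurs? a μ)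

-- The valuation making n true exactly when neg n occurs in the clause satisfies
-- no negative literal of the clause, so it satisfies a positive one.
clause-dual-pair : ∀ {κ φ} → κ ClauseOf φ → Valid φ → ∃₂ λ (o o′ : Occ κ) → DualOcc o o′
clause-dual-pair {κ} k valid with clause-true ρ k (valid ρ)
  where
  ρ : ℕ → Bool
  ρ n = does (occurs? (neg n) κ)
... | o , o-true with label o in eq
...   | pos n = let o′ , eq′ = does-true⁻ (occurs? (neg n) κ) o-true
                in o , o′ , trans (cong dual eq) (sym eq′)
...   | neg n = contradiction (trans (sym o-true) (cong not (dec-true (occurs? (neg n) κ) (o , eq)))) λ ()

completeness : ∀ {φ} → Simple φ → Valid φ → Cover φ
-- The initial context is `𝟘`, which has no occurrences and can be removed at the end.
completeness simple valid = transport ∨-identityʳ (cover-clauses simple λ k →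
  let o , o′ , dual-pair = clause-dual-pair k valid
  in axiom (λ { _ _ (∨ll c) → clause-edgeless k _ _ c }) (∨l o) (∨l o′) dual-pair)

mainTheorem2 : (φ : Form) → Simple φ →
    Valid φ ⇔ (Σ ℕ λ n → Σ (BiGraph (Fin n)) λ N →
    IsDualizingNet N × Σ (Fin n → Occ φ) λ f → IsSkewFibration N (𝒟 φ) f)
mainTheorem2 φ simple = mk⇔
  (λ valid → Cover⇒net (completeness simple valid))
  (λ (n , N , net , f , fib) → soundness N net simple f fib)
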